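{- Let $G$ be a finite simple undirected graph, let $\overline{G}$ be its complement, and let $\tau$ be the visiting ordering of a minBFS on $\overline{G}$. Then $G$ is a bipartite chain graph if and only if $\tau$ avoids both of the following patterns, i.e. there is no triple of vertices $a<_\tau b<_\tau c$ such that (1) $ab\in E(G)$ and $bc\in E(G)$; or (2) $ab\notin E(G)$, $ac\notin E(G)$ and $bc\in E(G)$.
   Context: A bipartite chain graph is a $2K_2$-free bipartite graph, i.e. a bipartite graph that has no two disjoint edges $xy$, $x'y'$ with no further edge among $\{x,y,x',y'\}$. Equivalently, it has a bipartition $(A,B)$ such that the neighbourhoods of the vertices of $A$ are totally ordered by inclusion, and so are those of $B$. BFS is the standard Breadth First Search implemented with a queue. A minBFS is a BFS in which ties between eligible vertices are broken by smallest degree (degrees in the searched graph, here $\overline{G}$; a fixed priority during the whole search): the search starts at a vertex of minimum degree; when a vertex is processed, its not yet discovered neighbours are put in the queue in increasing order of degree (remaining ties broken arbitrarily); if the searched graph is disconnected, when the queue is empty the search restarts at an unvisited vertex of smallest degree. -}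

module Defs where

open import Data.Bool.Base using (Bool)
open import Data.Fin.Base using (Fin)
open import Data.Fin.Properties using (_≟_)
open import Data.List.Base using (List; []; _∷_; _++_; [_]; length; filter; allFin)
open import Data.List.Membership.Propositional using (_∈_; _∉_)
open import Data.List.Relation.Binary.Sublist.Propositional using (_⊆_)
open import Data.List.Relation.Unary.AllPairs using (AllPairs)
open import Data.List.Relation.Unary.Unique.Propositional using (Unique)
open import Data.Nat.Base using (ℕ; _≤_)
open import Data.Product using (_×_; _,_; Σ-syntax; ∃-syntax)
open import Data.Sum using (_⊎_)
open import Function.Bundles using (_⇔_)
open import Level using (0ℓ)
open import Relation.Binary.Construct.Closure.ReflexiveTransitive using (Star)
open import Relation.Binary.Core using (Rel)
open import Relation.Binary.Definitions using (Symmetric; Decidable)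
open import Relation.Binary.PropositionalEquality using (_≢_; refl; sym)
open import Relation.Nullary using (¬_)
open import Relation.Nullary.Decidable using (¬?; _×-dec_)

-- Adjacency is required to be decidable, as is implicit for a finite graph.
record Graph (n : ℕ) : Set₁ where
  field
    Adj       : Rel (Fin n) 0ℓ
    adj?      : Decidable Adj
    symmetric : Symmetric Adj
    loopless  : ∀ v → ¬ Adj v v

  degree : Fin n → ℕ
  degree v = length (filter (adj? v) (allFin n))

open Graph public

complement : ∀ {n} → Graph n → Graph n
complement G .Adj u v = u ≢ v × ¬ Adj G u v
complement G .adj? u v = ¬? (u ≟ v) ×-dec ¬? (adj? G u v)
complement G .symmetric (u≢v , ¬uv) =
  (λ v≡u → u≢v (sym v≡u)) , (λ vu → ¬uv (symmetric G vu))
complement G .loopless v (v≢v , _) = v≢v refl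

Bipartite : ∀ {n} → Graph n → Set
Bipartite {n} G =
  Σ[ side ∈ (Fin n → Bool) ] (∀ u v → Adj G u v → side u ≢ side v)

TwoK₂Free : ∀ {n} → Graph n → Set
TwoK₂Free G =
  ¬ (∃[ x ] ∃[ y ] ∃[ x′ ] ∃[ y′ ]
       Adj G x y × Adj G x′ y′
     × (x ≢ x′ × x ≢ y′ × y ≢ x′ × y ≢ y′)
     × (¬ Adj G x x′ × ¬ Adj G x y′ × ¬ Adj G y x′ × ¬ Adj G y y′))

BipartiteChain : ∀ {n} → Graph n → Set
BipartiteChain G = Bipartite G × TwoK₂Free G

record State (n : ℕ) : Set where
  constructor ⟨_∣_⟩
  field
    queue   : List (Fin n)
    visited : List (Fin n)

-- One step of a minBFS on H. The front of the queue is its head; the visited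
-- vertices are listed earliest first. A vertex is discovered once it is in the
-- queue or visited. The initial choice of a vertex is the instance
-- visited = [] of restart.
data Step {n} (H : Graph n) : Rel (State n) 0ℓ where
  restart : ∀ {visited} v →
            v ∉ visited →
            (∀ w → w ∉ visited → degree H v ≤ degree H w) →
            Step H ⟨ [] ∣ visited ⟩ ⟨ [ v ] ∣ visited ⟩
  process : ∀ {v queue visited} new →
            (∀ w → w ∈ new ⇔ (Adj H v w × w ∉ v ∷ queue × w ∉ visited)) →
            Unique new →
            AllPairs (λ u w → degree H u ≤ degree H w) new →
            Step H ⟨ v ∷ queue ∣ visited ⟩ ⟨ queue ++ new ∣ visited ++ [ v ] ⟩

MinBFSOrdering : ∀ {n} → Graph n → List (Fin n) → Set
MinBFSOrdering H τ = Star (Step H) ⟨ [] ∣ [] ⟩ ⟨ [] ∣ τ ⟩ × (∀ v → v ∈ τ)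

-- u occurs before v in τ; the library's _⊆_ is the (order-preserving) sublist
-- relation.
_<[_]_ : ∀ {n} → Fin n → List (Fin n) → Fin n → Set
u <[ τ ] v = (u ∷ v ∷ []) ⊆ τ

Pattern₁ Pattern₂ : ∀ {n} → Graph n → (a b c : Fin n) → Set
Pattern₁ G a b c = Adj G a b × Adj G b c
Pattern₂ G a b c = ¬ Adj G a b × ¬ Adj G a c × Adj G b c

AvoidsPatterns : ∀ {n} → Graph n → List (Fin n) → Set
AvoidsPatterns G τ =
  ¬ (∃[ a ] ∃[ b ] ∃[ c ]
       a <[ τ ] b × b <[ τ ] c × (Pattern₁ G a b c ⊎ Pattern₂ G a b c))

{-# OPTIONS --safe #-}

-- A minBFS on the complement starts at a vertex s of maximum G-degree, then
-- visits the non-neighbours of s by decreasing G-degree, and only then the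
-- neighbours of s. In a bipartite chain graph the latter are independent
-- (no triangles), and so are the former (an edge uv among them would force
-- N(s) ⊊ N(u) or N(s) ⊊ N(v)). Hence every edge goes from the first part to the
-- second, which excludes pattern (1), and non-neighbours of s have neighbourhoods
-- decreasing along τ, which excludes pattern (2). Conversely, avoiding (1) makes
-- "has a later neighbour" a proper 2-colouring, and the earliest vertex of
-- an induced 2K₂ together with the opposite edge forms pattern (2).
module Submission where

open import Data.Bool.Base using (Bool; not)
open import Data.Bool.Properties using (¬-not) renaming (_≟_ to _≟ᵇ_)
open import Data.Empty using (⊥)
open import Data.Fin.Base using (Fin; zero; suc)
open import Data.Fin.Properties using (_≟_; any?; injective⇒≤)
open import Data.List.Base using (List; []; _∷_; _++_; [_]; length; filter; allFin; lookup)
open import Data.List.Membership.Propositional using (_∈_; _∉_)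
open import Data.List.Membership.Propositional.Properties
  using (∈-++⁺ˡ; ∈-++⁺ʳ; ∈-++⁻; ∈-allFin; ∈-filter⁺; ∈-filter⁻; ∈-lookup)
open import Data.List.Membership.Setoid.Properties using (index-injective)
open import Data.List.Properties using (++-assoc; ++-identityʳ)
open import Data.List.Relation.Binary.Sublist.DecPropositional using (_⊆?_)
open import Data.List.Relation.Binary.Sublist.Propositional
  using (_⊆_; _∷_; _∷ʳ_; from∈; to∈; ⊆-trans; minimum)
open import Data.List.Relation.Binary.Sublist.Propositional.Properties using (∷ˡ⁻)
open import Data.List.Relation.Unary.All as All using (_∷_)
open import Data.List.Relation.Unary.AllPairs using (AllPairs; _∷_)
open import Data.List.Relation.Unary.Any using (here; there; index)
open import Data.List.Relation.Unary.Unique.Propositional using (Unique)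
open import Data.List.Relation.Unary.Unique.Propositional.Properties
  using (allFin⁺; filter⁺)
open import Data.Nat.Base using (ℕ; _≤_; _<_; s≤s⁻¹)
open import Data.Nat.Properties using (≤⇒≯)
open import Data.Product using (_×_; _,_; proj₁; proj₂; ∃-syntax)
open import Data.Sum using (_⊎_; inj₁; inj₂)
open import Function.Base using (_∘_)
open import Function.Bundles using (_⇔_; mk⇔; module Equivalence)
open import Level using (0ℓ)
open import Relation.Binary.Construct.Closure.ReflexiveTransitive using (Star; ε; _◅_)
open import Relation.Binary.Core using (Rel)
open import Relation.Binary.PropositionalEquality
  using (_≡_; _≢_; refl; sym; trans; cong; setoid)
open import Relation.Nullary using (¬_; Dec; yes; no; does; contradiction)
open import Relation.Nullary.Decidable using (_×-dec_; dec-true; dec-false)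
open import Defs

-- Lists: counting and order of occurrence.

lookup-injective : ∀ {A : Set} {xs : List A} → Unique xs →
                   ∀ {i j} → lookup xs i ≡ lookup xs j → i ≡ j
lookup-injective (_ ∷ _)    {zero}  {zero}  _  = refl
lookup-injective (x∉xs ∷ _) {zero}  {suc j} eq = contradiction eq (All.lookup x∉xs (∈-lookup j))
lookup-injective (x∉xs ∷ _) {suc i} {zero}  eq = contradiction (sym eq) (All.lookup x∉xs (∈-lookup i))
lookup-injective (_ ∷ xs!)  {suc i} {suc j} eq = cong suc (lookup-injective xs! eq)

-- Pigeonhole: positions in `xs` map injectively to positions of the same elements in `ys`.
unique⇒length≤ : ∀ {A : Set} {xs ys : List A} → Unique xs →
                 (∀ {x} → x ∈ xs → x ∈ ys) → length xs ≤ length ys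
unique⇒length≤ {A} {xs} xs! xs⊆ys =
  injective⇒≤ {f = λ i → index (xs⊆ys (∈-lookup {xs = xs} i))}
    (λ {i} {j} eq → lookup-injective xs!
      (index-injective (setoid A) (xs⊆ys (∈-lookup i)) (xs⊆ys (∈-lookup j)) eq))

module _ {A : Set} where

  ⊆-pair-++⁻ : ∀ {u v : A} xs {ys} → (u ∷ v ∷ []) ⊆ (xs ++ ys) →
               v ∈ ys ⊎ (u ∷ v ∷ []) ⊆ xs
  ⊆-pair-++⁻ []       p = inj₁ (to∈ (∷ˡ⁻ p))
  ⊆-pair-++⁻ (x ∷ xs) (_ ∷ʳ p) with ⊆-pair-++⁻ xs p
  ... | inj₁ v∈ys = inj₁ v∈ys
  ... | inj₂ q    = inj₂ (x ∷ʳ q)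
  ⊆-pair-++⁻ (x ∷ xs) (refl ∷ p) with ∈-++⁻ xs (to∈ p)
  ... | inj₁ v∈xs = inj₂ (refl ∷ from∈ v∈xs)
  ... | inj₂ v∈ys = inj₁ v∈ys

  ⊆-pair-total : ∀ {u v : A} {xs} → u ∈ xs → v ∈ xs → u ≢ v →
                 (u ∷ v ∷ []) ⊆ xs ⊎ (v ∷ u ∷ []) ⊆ xs
  ⊆-pair-total (here refl) (here refl) u≢v = contradiction refl u≢v
  ⊆-pair-total (here refl) (there v∈)  _   = inj₁ (refl ∷ from∈ v∈)
  ⊆-pair-total (there u∈)  (here refl) _   = inj₂ (refl ∷ from∈ u∈)
  ⊆-pair-total (there u∈)  (there v∈)  u≢v with ⊆-pair-total u∈ v∈ u≢v
  ... | inj₁ p = inj₁ (_ ∷ʳ p)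
  ... | inj₂ p = inj₂ (_ ∷ʳ p)

  AllPairs-⊆-pair : ∀ {R : Rel A 0ℓ} {u v xs} → AllPairs R xs → (u ∷ v ∷ []) ⊆ xs → R u v
  AllPairs-⊆-pair (_ ∷ rs) (_ ∷ʳ p)   = AllPairs-⊆-pair rs p
  AllPairs-⊆-pair (r ∷ _)  (refl ∷ p) = All.lookup r (to∈ p)

-- Runs of a minBFS.

module _ {n : ℕ} {H : Graph n} where

  -- The queue is first in, first out, so its present content is visited next, and everything after
  -- it is still undiscovered. Applied once the first vertex is processed, this cuts `τ` into that
  -- vertex, its neighbours in `H` and the rest.
  run-extends : ∀ {queue visited τ} → Star (Step H) ⟨ queue ∣ visited ⟩ ⟨ [] ∣ τ ⟩ →
                ∃[ rest ] τ ≡ visited ++ queue ++ rest ×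
                          (∀ {w} → w ∈ rest → w ∉ visited × w ∉ queue)
  run-extends {visited = vis} ε = [] , sym (++-identityʳ vis) , λ ()
  run-extends (restart v v∉ _ ◅ steps) with run-extends steps
  ... | rest , eq , fresh = v ∷ rest , eq , λ
    { (here refl) → v∉ , λ ()
    ; (there w∈)  → proj₁ (fresh w∈) , λ () }
  run-extends {v ∷ queue} {vis} (process new new⇔ _ _ ◅ steps) with run-extends steps
  ... | rest , eq , fresh = new ++ rest , trans eq regroup , fresh′
    where
    regroup : (vis ++ [ v ]) ++ (queue ++ new) ++ rest ≡ vis ++ v ∷ queue ++ new ++ rest
    regroup rewrite ++-assoc vis [ v ] ((queue ++ new) ++ rest) | ++-assoc queue new rest = refl

    fresh′ : ∀ {w} → w ∈ new ++ rest → w ∉ vis × w ∉ v ∷ queue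
    fresh′ w∈ with ∈-++⁻ new w∈
    ... | inj₁ w∈new with Equivalence.to (new⇔ _) w∈new
    ...   | _ , w∉queue , w∉vis = w∉vis , w∉queue
    fresh′ w∈ | inj₂ w∈rest with fresh w∈rest
    -- Processing moves `v` from the queue to the visited list, so `v` is excluded through the
    -- longer visited list.
    ... | w∉vis , w∉queue = w∉vis ∘ ∈-++⁺ˡ , λ
      { (here w≡v) → w∉vis (∈-++⁺ʳ vis (here w≡v))
      ; (there w∈queue) → w∉queue (∈-++⁺ˡ w∈queue) }

-- Neighbourhood inclusions and degrees.

module _ {n : ℕ} (G : Graph n) where

  private
    H = complement G

  -- The lists are the closed neighbourhoods in the complement.
  complement-degree-< : ∀ {u v w} → (∀ {x} → Adj G u x → Adj G v x) →
                        Adj G v w → ¬ Adj G u w → degree H v < degree H u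
  -- The lengths give 2 + `degree H v` ≤ 1 + `degree H u`: the additional `w` lies in `N[u]` but not
  -- in `N[v]`.
  complement-degree-< {u} {v} {w} Nu⊆Nv vw ¬uw = s≤s⁻¹ (unique⇒length≤ unique incl)
    where
    N[v] = v ∷ filter (adj? H v) (allFin n)
    N[u] = u ∷ filter (adj? H u) (allFin n)

    ∈-N[u] : ∀ {x} → ¬ Adj G u x → x ∈ N[u]
    ∈-N[u] {x} ¬ux with u ≟ x
    ... | yes refl = here refl
    ... | no u≢x   = there (∈-filter⁺ (adj? H u) (∈-allFin x) (u≢x , ¬ux))

    N[v]-adj : ∀ {x} → x ∈ N[v] → ¬ Adj G v x
    N[v]-adj (here refl) = loopless G v
    N[v]-adj (there x∈)  = proj₂ (proj₂ (∈-filter⁻ (adj? H v) {xs = allFin n} x∈))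

    incl : ∀ {x} → x ∈ w ∷ N[v] → x ∈ N[u]
    incl (here refl) = ∈-N[u] ¬uw
    incl (there x∈)  = ∈-N[u] (N[v]-adj x∈ ∘ Nu⊆Nv)

    unique : Unique (w ∷ N[v])
    unique =
      All.tabulate (λ { x∈ refl → N[v]-adj x∈ vw }) ∷
      All.tabulate (λ { x∈ refl →
        loopless H v (proj₂ (∈-filter⁻ (adj? H v) {xs = allFin n} x∈)) }) ∷
      filter⁺ (adj? H v) (allFin⁺ n)

  bipartite⇒triangleFree : Bipartite G → ∀ {u v w} →
                           Adj G u v → Adj G v w → ¬ Adj G u w
  bipartite⇒triangleFree (side , proper) {u} {v} {w} uv vw uw =
    proper u w uw (trans (¬-not (proper u v uv)) (sym (¬-not (proper w v (symmetric G vw)))))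

  -- s is a vertex of maximum degree in G.
  module _ (chain : BipartiteChain G) {s} (s-min : ∀ w → degree H s ≤ degree H w) where

    private
      side    = proj₁ (proj₁ chain)
      proper  = proj₂ (proj₁ chain)
      2K₂free = proj₂ chain

    -- Given an edge `uv`, a neighbour of `s` missed by `u` would yield an induced 2K₂. So the
    -- neighbourhood of `u` contains that of `s`, and `v` besides, against the choice of `s`.
    nonNeighbours-sameSide : ∀ {u v} → side s ≡ side u →
                             ¬ Adj G s u → ¬ Adj G s v → ¬ Adj G u v
    nonNeighbours-sameSide {u} {v} s≡u ¬su ¬sv uv =
      ≤⇒≯ (s-min u) (complement-degree-< Ns⊆Nu uv ¬sv)
      where
      Ns⊆Nu : ∀ {w} → Adj G s w → Adj G u w
      Ns⊆Nu {w} sw with adj? G u w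
      ... | yes uw = uw
      ... | no ¬uw = contradiction
        (s , w , u , v , sw , uv ,
          -- Any coincidence would turn one of the two edges into an edge from `s` to `u` or `v`.
          ((λ { refl → ¬sv uv }) , (λ { refl → ¬su (symmetric G uv) }) ,
           (λ { refl → ¬su sw }) , (λ { refl → ¬sv sw })) ,
          (¬su , ¬sv , ¬uw ∘ symmetric G , ¬wv))
        2K₂free
        where
        -- `w` is opposite `s`, and `v` opposite `u`, hence both are on one side.
        ¬wv : ¬ Adj G w v
        ¬wv wv = proper w v wv
          (trans (¬-not (proper w s (symmetric G sw)))
            (trans (cong not s≡u) (sym (¬-not (proper v u (symmetric G uv))))))

    -- The ends of an edge lie on different sides, so one of them shares the side of `s`.
    nonNeighbours-independent : ∀ {u v} → ¬ Adj G s u → ¬ Adj G s v → ¬ Adj G u v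
    nonNeighbours-independent {u} {v} ¬su ¬sv uv with side s ≟ᵇ side u
    ... | yes s≡u = nonNeighbours-sameSide s≡u ¬su ¬sv uv
    ... | no s≢u  = nonNeighbours-sameSide s≡v ¬sv ¬su (symmetric G uv)
      where
      s≡v : side s ≡ side v
      s≡v = trans (¬-not s≢u) (sym (¬-not (proper v u (symmetric G uv))))

    -- A neighbour `w` of `a` missed by `b` would make `aw`, `bc` an induced 2K₂: `w` and `c` are
    -- both adjacent to `s`, so an edge `wc` would close a triangle. Hence `b` has all neighbours of
    -- `a` and also `c`.
    nonNeighbours-degree : ∀ {a b c} → ¬ Adj G s a → ¬ Adj G s b → Adj G b c →
                           ¬ Adj G a c → ¬ (degree H a ≤ degree H b)
    nonNeighbours-degree {a} {b} {c} ¬sa ¬sb bc ¬ac a≤b =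
      ≤⇒≯ a≤b (complement-degree-< Na⊆Nb bc ¬ac)
      where
      ¬ab = nonNeighbours-independent ¬sa ¬sb

      adjacent-to-s : ∀ {x y} → ¬ Adj G s x → Adj G x y → Adj G s y
      adjacent-to-s {y = y} ¬sx xy with adj? G s y
      ... | yes sy = sy
      ... | no ¬sy = contradiction xy (nonNeighbours-independent ¬sx ¬sy)

      Na⊆Nb : ∀ {w} → Adj G a w → Adj G b w
      Na⊆Nb {w} aw with adj? G b w
      ... | yes bw = bw
      ... | no ¬bw = contradiction
        (a , w , b , c , aw , bc ,
          ((λ { refl → ¬ac bc }) , (λ { refl → ¬ab (symmetric G bc) }) ,
           (λ { refl → ¬ab aw }) , (λ { refl → ¬ac aw })) ,
          (¬ab , ¬ac , ¬bw ∘ symmetric G ,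
           λ wc → bipartite⇒triangleFree (proj₁ chain)
                    (adjacent-to-s ¬sa aw) wc (adjacent-to-s ¬sb bc)))
        2K₂free

  -- From chain graphs to avoided patterns.

  chain⇒avoids : ∀ {τ} → Star (Step H) ⟨ [] ∣ [] ⟩ ⟨ [] ∣ τ ⟩ →
                 BipartiteChain G → AvoidsPatterns G τ
  chain⇒avoids ε _ (_ , _ , _ , () , _)
  chain⇒avoids (restart s _ s-min ◅ process new new⇔ _ sorted ◅ steps) chain
    with run-extends steps
  ... | rest , refl , fresh = λ
    { (_ , _ , _ , a<b , b<c , inj₁ (ab , bc)) →
        bipartite⇒triangleFree (proj₁ chain) (head-adj a<b ab) bc (head-adj b<c bc)
    ; (_ , _ , _ , a<b , b<c , inj₂ (¬ab , ¬ac , bc)) →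
        noPattern₂ (order a<b) ¬ac bc (head-adj b<c bc) }
    where
    s-max : ∀ w → degree H s ≤ degree H w
    s-max w = s-min w λ ()

    order : ∀ {u v} → u <[ s ∷ new ++ rest ] v →
            v ∈ rest ⊎ (u ≡ s × v ∈ new) ⊎ u <[ new ] v
    order (refl ∷ p) with ∈-++⁻ new (to∈ p)
    ... | inj₁ v∈new  = inj₂ (inj₁ (refl , v∈new))
    ... | inj₂ v∈rest = inj₁ v∈rest
    order (_ ∷ʳ p) with ⊆-pair-++⁻ new p
    ... | inj₁ v∈rest = inj₁ v∈rest
    ... | inj₂ u<v    = inj₂ (inj₂ u<v)

    new-nonadj : ∀ {w} → w ∈ new → ¬ Adj G s w
    new-nonadj w∈ = proj₂ (proj₁ (Equivalence.to (new⇔ _) w∈))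

    rest-adj : ∀ {w} → w ∈ rest → Adj G s w
    rest-adj {w} w∈ with adj? G s w | fresh w∈
    ... | yes sw | _ = sw
    -- A non-neighbour of `s` in `G` would have been queued when `s` was processed.
    ... | no ¬sw | w∉s , w∉new = contradiction
      (Equivalence.from (new⇔ w) (((λ s≡w → w∉s (here (sym s≡w))) , ¬sw) , w∉s , λ ()))
      w∉new

    <-nonadj : ∀ {u v} → u <[ new ] v → ¬ Adj G s u × ¬ Adj G s v
    <-nonadj u<v = new-nonadj (to∈ (⊆-trans (refl ∷ minimum _) u<v)) , new-nonadj (to∈ (∷ˡ⁻ u<v))

    head-adj : ∀ {u v} → u <[ s ∷ new ++ rest ] v → Adj G u v → Adj G s v
    head-adj u<v uv with order u<v
    ... | inj₁ v∈rest             = rest-adj v∈rest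
    ... | inj₂ (inj₁ (refl , _)) = uv
    ... | inj₂ (inj₂ u<v′) with <-nonadj u<v′
    ...   | ¬su , ¬sv = contradiction uv (nonNeighbours-independent chain s-max ¬su ¬sv)

    -- The place of `b` decides: in `rest` it closes a triangle with `s` and `c`; with `a` equal to
    -- `s` the edge `sc` is `ac`; inside `new` the sorting by degree is violated.
    noPattern₂ : ∀ {a b c} → b ∈ rest ⊎ (a ≡ s × b ∈ new) ⊎ a <[ new ] b →
                 ¬ Adj G a c → Adj G b c → ¬ Adj G s c
    noPattern₂ (inj₁ b∈rest) _ bc sc =
      bipartite⇒triangleFree (proj₁ chain) (rest-adj b∈rest) bc sc
    noPattern₂ (inj₂ (inj₁ (refl , _))) ¬ac _ sc = ¬ac sc
    noPattern₂ (inj₂ (inj₂ a<b)) ¬ac bc _ with <-nonadj a<b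
    ... | ¬sa , ¬sb =
      nonNeighbours-degree chain s-max ¬sa ¬sb bc ¬ac (AllPairs-⊆-pair sorted a<b)

  -- From avoided patterns to chain graphs.

  module _ {τ} (complete : ∀ v → v ∈ τ) (avoids : AvoidsPatterns G τ) where

    private
      hasLater? : ∀ v → Dec (∃[ w ] Adj G v w × v <[ τ ] w)
      hasLater? v = any? λ w → adj? G v w ×-dec _⊆?_ _≟_ (v ∷ w ∷ []) τ

      adj-≢ : ∀ {u v} → Adj G u v → u ≢ v
      adj-≢ uv refl = loopless G _ uv

    avoids⇒bipartite : Bipartite G
    avoids⇒bipartite = side , proper
      where
      side : Fin n → Bool
      side v = does (hasLater? v)

      proper-< : ∀ {u v} → u <[ τ ] v → Adj G u v → side u ≢ side v
      proper-< {u} {v} u<v uv eq with trans (sym later-u) (trans eq ¬later-v)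
        where
        later-u  = dec-true (hasLater? u) (v , uv , u<v)
        -- A neighbour `w` of `v` after `v` would complete pattern (1) on `u`, `v`, `w`.
        ¬later-v = dec-false (hasLater? v)
          λ (w , vw , v<w) → avoids (u , v , w , u<v , v<w , inj₁ (uv , vw))
      ... | ()

      proper : ∀ u v → Adj G u v → side u ≢ side v
      proper u v uv with ⊆-pair-total (complete u) (complete v) (adj-≢ uv)
      ... | inj₁ u<v = proper-< u<v uv
      ... | inj₂ v<u = proper-< v<u (symmetric G uv) ∘ sym

    -- The earlier of `x` and `x′` precedes both ends of the other edge, which gives pattern (2).
    oriented-2K₂-absurd : ∀ {x y x′ y′} → x <[ τ ] y → x′ <[ τ ] y′ →
      Adj G x y → Adj G x′ y′ → x ≢ x′ →
      ¬ Adj G x x′ → ¬ Adj G x y′ → ¬ Adj G x′ y → ⊥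
    oriented-2K₂-absurd x<y x′<y′ xy x′y′ x≢x′ ¬xx′ ¬xy′ ¬x′y
      with ⊆-pair-total (complete _) (complete _) x≢x′
    ... | inj₁ x<x′ = avoids (_ , _ , _ , x<x′ , x′<y′ , inj₂ (¬xx′ , ¬xy′ , x′y′))
    ... | inj₂ x′<x = avoids (_ , _ , _ , x′<x , x<y , inj₂ (¬xx′ ∘ symmetric G , ¬x′y , xy))

    avoids⇒2K₂free : TwoK₂Free G
    avoids⇒2K₂free (x , y , x′ , y′ , xy , x′y′ ,
                    (x≢x′ , x≢y′ , y≢x′ , y≢y′) , (¬xx′ , ¬xy′ , ¬yx′ , ¬yy′))
      with ⊆-pair-total (complete x) (complete y) (adj-≢ xy)
         | ⊆-pair-total (complete x′) (complete y′) (adj-≢ x′y′)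
    ... | inj₁ p | inj₁ q = oriented-2K₂-absurd p q xy x′y′ x≢x′ ¬xx′ ¬xy′ (¬yx′ ∘ symmetric G)
    ... | inj₁ p | inj₂ q = oriented-2K₂-absurd p q xy y′x′ x≢y′ ¬xy′ ¬xx′ (¬yy′ ∘ symmetric G)
      where y′x′ = symmetric G x′y′
    ... | inj₂ p | inj₁ q = oriented-2K₂-absurd p q yx x′y′ y≢x′ ¬yx′ ¬yy′ (¬xx′ ∘ symmetric G)
      where yx = symmetric G xy
    ... | inj₂ p | inj₂ q = oriented-2K₂-absurd p q yx y′x′ y≢y′ ¬yy′ ¬yx′ (¬xy′ ∘ symmetric G)
      where
      yx   = symmetric G xy
      y′x′ = symmetric G x′y′

theorem1 : ∀ (n : ℕ) (G : Graph n) (τ : List (Fin n)) →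
    MinBFSOrdering (complement G) τ →
    BipartiteChain G ⇔ AvoidsPatterns G τ
theorem1 n G τ (run , complete) =
  mk⇔ (chain⇒avoids G run)
      (λ avoids → avoids⇒bipartite G complete avoids , avoids⇒2K₂free G complete avoids)
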